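{- Let $k\geq 2$ be an integer and let $F$ be a finite graph with vertex cover number $\beta(F)\geq k+1$. Then $\mathrm{sat}_k(n,\text{Berge- }F)=O(n)$.
   Context: $\beta(F)$ is the minimum size of a set $A\subseteq V(F)$ such that every edge of $F$ has an endpoint in $A$. For a graph $F$, a hypergraph $H$ is Berge-$F$ if there is a bijection $\phi:E(F)\to E(H)$ with $e\subseteq\phi(e)$ for all $e\in E(F)$ (with $V(F)$ identified with a subset of $V(H)$); a hypergraph contains a Berge-$F$ if some subhypergraph of it is Berge-$F$. A $k$-uniform hypergraph on $n$ vertices is Berge-$F$-saturated if it contains no Berge-$F$ but adding any new $k$-element hyperedge creates one. $\mathrm{sat}_k(n,\text{Berge- }F)$ is the minimum number of hyperedges in a $k$-uniform Berge-$F$-saturated hypergraph on $n$ vertices. -}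

module Defs where

open import Data.Nat using (ℕ; suc; _≤_; _*_)
open import Data.Fin using (Fin)
open import Data.Fin.Subset using (Subset; ∣_∣) renaming (_∈_ to _∈ₛ_)
open import Data.List using (List; _∷_; length; lookup)
open import Data.List.Relation.Unary.All using (All)
open import Data.List.Relation.Unary.Unique.Propositional using (Unique)
open import Data.List.Membership.Propositional using () renaming (_∈_ to _∈ₗ_)
open import Data.Product using (Σ; _×_; ∃-syntax)
open import Relation.Binary.PropositionalEquality using (_≡_)
open import Relation.Nullary using (¬_)
open import Function.Definitions using (Injective)

record Graph : Set where
  field
    m       : ℕ
    edges   : List (Subset m)
    edges-2 : All (λ e → ∣ e ∣ ≡ 2) edges
    edges-u : Unique edges
open Graph public

IsVertexCover : (F : Graph) → Subset (m F) → Set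
IsVertexCover F A = All (λ e → ∃[ x ] (x ∈ₛ e × x ∈ₛ A)) (edges F)

CoverNumberAtLeast : Graph → ℕ → Set
CoverNumberAtLeast F b = (A : Subset (m F)) → IsVertexCover F A → b ≤ ∣ A ∣

-- A hypergraph on vertex set Fin n is a list of hyperedges (subsets of Fin n).
-- H contains a Berge-F: an injection ι : V(F) → V(H) and an injection φ from
-- E(F) into E(H) (i.e. a bijection onto a subhypergraph) with ι(e) ⊆ φ(e).
ContainsBerge : (F : Graph) {n : ℕ} → List (Subset n) → Set
ContainsBerge F {n} H =
  Σ (Fin (m F) → Fin n) λ ι → Injective _≡_ _≡_ ι ×
  Σ (Fin (length (edges F)) → Fin (length H)) λ φ → Injective _≡_ _≡_ φ ×
  ((i : Fin (length (edges F))) (x : Fin (m F)) →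
     x ∈ₛ lookup (edges F) i → ι x ∈ₛ lookup H (φ i))

Saturated : (F : Graph) (k n : ℕ) → List (Subset n) → Set
Saturated F k n H =
  All (λ e → ∣ e ∣ ≡ k) H × Unique H × ¬ ContainsBerge F H ×
  ((e : Subset n) → ∣ e ∣ ≡ k → ¬ (e ∈ₗ H) → ContainsBerge F (e ∷ H))

{-# OPTIONS --safe #-}
-- Let b + 1 be the vertex cover number of F, so b ≥ k, and call b of the vertices hubs. The k-sets
-- with at most one vertex outside the hubs contain no Berge-F, since the hubs cover every edge of a
-- copy; extend them greedily to a saturated H. Suppose a vertex s outside the hubs is the centre of
-- a large Berge star in H whose leaves avoid the hubs. Then H contains a Berge-F: put b vertices of
-- a minimum cover on the hubs, the remaining one on s and all other vertices on leaves; the edges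
-- from s to leaves use rays of the star, all others meet a hub and use the initial k-sets, of which
-- there are enough because b ≥ k. So no such star exists, and picking rays greedily shows that all
-- hyperedges through s lie in one set of bounded size. Hence boundedly many hyperedges of H contain
-- s, and H has O(n) hyperedges.

module Submission where

open import Defs hiding (m)
open import Data.Bool.Properties using () renaming (_≟_ to _≟ᵇ_)
open import Data.Fin
  using (Fin; zero; suc; _↑ˡ_; _↑ʳ_; inject₁; fromℕ; splitAt; toℕ; finToFun; funToFin)
open import Data.Fin.Properties
  using (_≟_; any?; all?; ↑ˡ-injective; ↑ʳ-injective; injective⇒≤; suc-injective;
    inject₁-injective; fromℕ≢inject₁; finToFun-funToFin; splitAt⁻¹-↑ˡ; splitAt⁻¹-↑ʳ;
    toℕ-inject₁)
open import Data.Fin.Subset using (Subset; inside; outside; ∣_∣; ⁅_⁆; ⊤; ⊥; ∁; _∪_; _∈_; _∉_; _⊆_)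
open import Data.Fin.Subset.Properties
  using (_∈?_; anySubset?; ∣⊥∣≡0; ∣⊤∣≡n; ∣⁅x⁆∣≡1; ∣∁p∣≡n∸∣p∣; x∈⁅x⁆; x∈⁅y⁆⇒x≡y; x≢y⇒x∉⁅y⁆;
    x∈p∪q⁻; x∈p∪q⁺; p⊆p∪q; q⊆p∪q; ∪-comm; ∪-identityˡ; ∪-identityʳ; ⊆-refl; ⊆-trans; ∉⊥; ∈⊤; ⊆⊤;
    drop-∷-⊆; s⊆s; in⊆in; x∉p⇒x∈∁p; x∈p⇒x∉∁p; x∉∁p⇒x∈p)
open import Data.List
  using (List; []; _∷_; length; lookup; filter; allFin; concatMap; deduplicate)
  renaming (map to mapₗ; _++_ to _++ₗ_)
open import Data.List.Membership.Propositional
  using (lose; find) renaming (_∈_ to _∈ₗ_; _∉_ to _∉ₗ_)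
open import Data.List.Membership.Propositional.Properties
  using (∈-lookup; ∈-filter⁺; ∈-filter⁻; ∈-++⁺ˡ; ∈-++⁺ʳ; ∈-map⁺; ∈-allFin; ∈-deduplicate⁺;
    ∈-deduplicate⁻)
import Data.List.Membership.Setoid.Properties as Membership
import Data.List.Properties as List
open import Data.List.Relation.Binary.Subset.Propositional using () renaming (_⊆_ to _⊆ₗ_)
open import Data.List.Relation.Unary.All as All using (All; []; _∷_)
open import Data.List.Relation.Unary.AllPairs using ([]; _∷_)
open import Data.List.Relation.Unary.Any as Any using (here; there; index)
open import Data.List.Relation.Unary.Any.Properties using (concatMap⁺; lookup-index)
import Data.List.Relation.Unary.Unique.DecPropositional as UniqueDec
open import Data.List.Relation.Unary.Unique.DecPropositional.Properties using (deduplicate-!)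
open import Data.List.Relation.Unary.Unique.Propositional using (Unique)
open import Data.Nat
  using (ℕ; zero; suc; _+_; _*_; _^_; _∸_; _≤_; _<_; z≤n; s≤s; _<?_; _≤′_; ≤′-refl; ≤′-step)
open import Data.Nat.Induction using (<-wellFounded)
open import Data.Nat.Properties as ℕ using (≤-trans; ≤-reflexive; +-mono-≤; ≮⇒≥)
open import Data.Product using (Σ; _×_; _,_; proj₁; proj₂; ∃; ∃-syntax; ∃₂)
open import Data.Sum using (_⊎_; inj₁; inj₂; [_,_]′)
open import Data.Vec using ([]; _∷_; _++_; tabulate)
open import Data.Vec.Base using (here; there)
open import Data.Vec.Functional using () renaming (_∷_ to _∷ᶠ_)
open import Data.Vec.Properties
  using (≡-dec; ++-injectiveˡ; ++-injectiveʳ; lookup⇒[]=; []=⇒lookup; lookup∘tabulate;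
    ∷-injectiveʳ)
open import Function using (_∘_; id)
open import Function.Definitions using (Injective)
open import Induction.WellFounded using (Acc; acc)
open import Relation.Binary.Definitions using (DecidableEquality)
open import Relation.Binary.PropositionalEquality
  using (_≡_; _≢_; refl; sym; trans; cong; cong₂; subst; _≗_; setoid; ≢-sym)
open import Relation.Nullary using (¬_; Dec; yes; no; contradiction; ¬?; does)
open import Relation.Nullary.Decidable using (map′; _×-dec_; _→-dec_; decidable-stable; dec-true)
open import Relation.Unary using (Decidable)

private variable
  m n b : ℕ

_≟ˢ_ : DecidableEquality (Subset n)
_≟ˢ_ = ≡-dec _≟ᵇ_

-- Cardinality and enumeration of subsets

∣p∪q∣≤∣p∣+∣q∣ : (p q : Subset n) → ∣ p ∪ q ∣ ≤ ∣ p ∣ + ∣ q ∣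
∣p∪q∣≤∣p∣+∣q∣ []            []            = z≤n
∣p∪q∣≤∣p∣+∣q∣ (outside ∷ p) (outside ∷ q) = ∣p∪q∣≤∣p∣+∣q∣ p q
∣p∪q∣≤∣p∣+∣q∣ (inside  ∷ p) (outside ∷ q) = s≤s (∣p∪q∣≤∣p∣+∣q∣ p q)
∣p∪q∣≤∣p∣+∣q∣ (outside ∷ p) (inside  ∷ q) =
  ≤-trans (s≤s (∣p∪q∣≤∣p∣+∣q∣ p q)) (≤-reflexive (sym (ℕ.+-suc ∣ p ∣ ∣ q ∣)))
∣p∪q∣≤∣p∣+∣q∣ (inside  ∷ p) (inside  ∷ q) =
  s≤s (≤-trans (∣p∪q∣≤∣p∣+∣q∣ p q) (ℕ.+-monoʳ-≤ ∣ p ∣ (ℕ.n≤1+n ∣ q ∣)))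

∣⁅x⁆∪⁅y⁆∣≤2 : (x y : Fin n) → ∣ ⁅ x ⁆ ∪ ⁅ y ⁆ ∣ ≤ 2
∣⁅x⁆∪⁅y⁆∣≤2 x y =
  ≤-trans (∣p∪q∣≤∣p∣+∣q∣ ⁅ x ⁆ ⁅ y ⁆) (≤-reflexive (cong₂ _+_ (∣⁅x⁆∣≡1 x) (∣⁅x⁆∣≡1 y)))

∣⁅x⁆∪⁅y⁆∣≡2 : {x y : Fin n} → x ≢ y → ∣ ⁅ x ⁆ ∪ ⁅ y ⁆ ∣ ≡ 2
∣⁅x⁆∪⁅y⁆∣≡2 {x = zero}  {zero}  x≢y = contradiction refl x≢y
∣⁅x⁆∪⁅y⁆∣≡2 {x = zero}  {suc y} x≢y = cong suc (trans (cong ∣_∣ (∪-identityˡ ⁅ y ⁆)) (∣⁅x⁆∣≡1 y))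
∣⁅x⁆∪⁅y⁆∣≡2 {x = suc x} {zero}  x≢y = cong suc (trans (cong ∣_∣ (∪-identityʳ ⁅ x ⁆)) (∣⁅x⁆∣≡1 x))
∣⁅x⁆∪⁅y⁆∣≡2 {x = suc x} {suc y} x≢y = ∣⁅x⁆∪⁅y⁆∣≡2 (x≢y ∘ cong suc)

∣p++q∣≡∣p∣+∣q∣ : (p : Subset m) (q : Subset n) → ∣ p ++ q ∣ ≡ ∣ p ∣ + ∣ q ∣
∣p++q∣≡∣p∣+∣q∣ []            q = refl
∣p++q∣≡∣p∣+∣q∣ (outside ∷ p) q = ∣p++q∣≡∣p∣+∣q∣ p q
∣p++q∣≡∣p∣+∣q∣ (inside  ∷ p) q = cong suc (∣p++q∣≡∣p∣+∣q∣ p q)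

∣p∣≡0⇒p≡⊥ : (p : Subset n) → ∣ p ∣ ≡ 0 → p ≡ ⊥
∣p∣≡0⇒p≡⊥ []            _  = refl
∣p∣≡0⇒p≡⊥ (outside ∷ p) eq = cong (outside ∷_) (∣p∣≡0⇒p≡⊥ p eq)

∣p∣≡1⇒p≡⁅x⁆ : (p : Subset n) → ∣ p ∣ ≡ 1 → ∃[ x ] p ≡ ⁅ x ⁆
∣p∣≡1⇒p≡⁅x⁆ (inside  ∷ p) eq = zero , cong (inside ∷_) (∣p∣≡0⇒p≡⊥ p (ℕ.suc-injective eq))
∣p∣≡1⇒p≡⁅x⁆ (outside ∷ p) eq =
  let x , p≡ = ∣p∣≡1⇒p≡⁅x⁆ p eq in suc x , cong (outside ∷_) p≡

∣p∣≡2⇒p≡⁅x⁆∪⁅y⁆ : (p : Subset n) → ∣ p ∣ ≡ 2 → ∃₂ λ x y → x ≢ y × p ≡ ⁅ x ⁆ ∪ ⁅ y ⁆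
∣p∣≡2⇒p≡⁅x⁆∪⁅y⁆ (inside  ∷ p) eq =
  let y , p≡ = ∣p∣≡1⇒p≡⁅x⁆ p (ℕ.suc-injective eq)
  in zero , suc y , (λ ()) , cong (inside ∷_) (trans p≡ (sym (∪-identityˡ ⁅ y ⁆)))
∣p∣≡2⇒p≡⁅x⁆∪⁅y⁆ (outside ∷ p) eq =
  let x , y , x≢y , p≡ = ∣p∣≡2⇒p≡⁅x⁆∪⁅y⁆ p eq
  in suc x , suc y , x≢y ∘ suc-injective , cong (outside ∷_) p≡

x∈⁅x⁆∪⁅y⁆ : (x y : Fin n) → x ∈ ⁅ x ⁆ ∪ ⁅ y ⁆
x∈⁅x⁆∪⁅y⁆ x y = x∈p∪q⁺ (inj₁ (x∈⁅x⁆ x))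

y∈⁅x⁆∪⁅y⁆ : (x y : Fin n) → y ∈ ⁅ x ⁆ ∪ ⁅ y ⁆
y∈⁅x⁆∪⁅y⁆ x y = x∈p∪q⁺ {p = ⁅ x ⁆} (inj₂ (x∈⁅x⁆ y))

∈-pair⁻ : {z : Fin n} (x y : Fin n) → z ∈ ⁅ x ⁆ ∪ ⁅ y ⁆ → z ≡ x ⊎ z ≡ y
∈-pair⁻ x y z∈ with x∈p∪q⁻ ⁅ x ⁆ ⁅ y ⁆ z∈
... | inj₁ z∈x = inj₁ (x∈⁅y⁆⇒x≡y x z∈x)
... | inj₂ z∈y = inj₂ (x∈⁅y⁆⇒x≡y y z∈y)

pair-injective : {x y x′ y′ : Fin n} → x ≢ y → ⁅ x ⁆ ∪ ⁅ y ⁆ ≡ ⁅ x′ ⁆ ∪ ⁅ y′ ⁆ →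
                 (x ≡ x′ × y ≡ y′) ⊎ (x ≡ y′ × y ≡ x′)
pair-injective {x = x} {y} {x′} {y′} x≢y eq
  with ∈-pair⁻ x′ y′ (subst (x ∈_) eq (x∈⁅x⁆∪⁅y⁆ x y))
     | ∈-pair⁻ x′ y′ (subst (y ∈_) eq (y∈⁅x⁆∪⁅y⁆ x y))
... | inj₁ p | inj₁ q = contradiction (trans p (sym q)) x≢y
... | inj₁ p | inj₂ q = inj₁ (p , q)
... | inj₂ p | inj₁ q = inj₂ (p , q)
... | inj₂ p | inj₂ q = contradiction (trans p (sym q)) x≢y

⁅⁆-injective : {x y : Fin n} → ⁅ x ⁆ ≡ ⁅ y ⁆ → x ≡ y
⁅⁆-injective {x = x} {y} eq = x∈⁅y⁆⇒x≡y y (subst (x ∈_) eq (x∈⁅x⁆ x))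

-- Subsets of `Fin (b + n)`, split into a first block (later the hubs) and a second block (the outer
-- vertices).

∈-++⁺ᴸ : {p : Subset m} (q : Subset n) {i : Fin m} → i ∈ p → (i ↑ˡ n) ∈ p ++ q
∈-++⁺ᴸ q here       = here
∈-++⁺ᴸ q (there i∈) = there (∈-++⁺ᴸ q i∈)

∈-++⁺ᴿ : (p : Subset m) {q : Subset n} {i : Fin n} → i ∈ q → (m ↑ʳ i) ∈ p ++ q
∈-++⁺ᴿ []      i∈ = i∈
∈-++⁺ᴿ (_ ∷ p) i∈ = there (∈-++⁺ᴿ p i∈)

∈-++⁻ᴿ : (p : Subset m) {q : Subset n} {i : Fin n} → (m ↑ʳ i) ∈ p ++ q → i ∈ q
∈-++⁻ᴿ []      i∈         = i∈
∈-++⁻ᴿ (_ ∷ p) (there i∈) = ∈-++⁻ᴿ p i∈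

↑ˡ≢↑ʳ : (i : Fin m) (j : Fin n) → i ↑ˡ n ≢ m ↑ʳ j
↑ˡ≢↑ʳ (suc i) j eq = ↑ˡ≢↑ʳ i j (suc-injective eq)

locate : ∀ b (z : Fin (b + n)) → (∃[ j ] j ↑ˡ n ≡ z) ⊎ (∃[ v ] b ↑ʳ v ≡ z)
locate b z with splitAt b z in eq
... | inj₁ j = inj₁ (j , splitAt⁻¹-↑ˡ eq)
... | inj₂ v = inj₂ (v , splitAt⁻¹-↑ʳ eq)

-- Enumerating, enlarging and listing subsets.

enumerate : (p : Subset n) → Fin ∣ p ∣ → Fin n
enumerate (outside ∷ p) i       = suc (enumerate p i)
enumerate (inside  ∷ p) zero    = zero
enumerate (inside  ∷ p) (suc i) = suc (enumerate p i)

enumerate-∈ : (p : Subset n) (i : Fin ∣ p ∣) → enumerate p i ∈ p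
enumerate-∈ (outside ∷ p) i       = there (enumerate-∈ p i)
enumerate-∈ (inside  ∷ p) zero    = here
enumerate-∈ (inside  ∷ p) (suc i) = there (enumerate-∈ p i)

enumerate-injective : (p : Subset n) → Injective _≡_ _≡_ (enumerate p)
enumerate-injective (outside ∷ p) {i}     {j}     eq = enumerate-injective p (suc-injective eq)
enumerate-injective (inside  ∷ p) {zero}  {zero}  eq = refl
enumerate-injective (inside  ∷ p) {suc i} {suc j} eq =
  cong suc (enumerate-injective p (suc-injective eq))

enumerate-surjective : (p : Subset n) {x : Fin n} → x ∈ p → ∃[ i ] enumerate p i ≡ x
enumerate-surjective (inside ∷ p) here = zero , refl
enumerate-surjective (inside ∷ p) (there x∈) =
  let i , eq = enumerate-surjective p x∈ in suc i , cong suc eq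
enumerate-surjective (outside ∷ p) (there x∈) =
  let i , eq = enumerate-surjective p x∈ in i , cong suc eq

enlarge : (p : Subset n) {r : ℕ} → ∣ p ∣ ≤ r → r ≤ n → ∃[ q ] p ⊆ q × ∣ q ∣ ≡ r
enlarge {n = zero} [] {zero} _ _ = [] , ⊆-refl , refl
enlarge (inside ∷ p) {suc r} (s≤s ∣p∣≤r) (s≤s r≤n) =
  let q , p⊆q , ∣q∣≡r = enlarge p ∣p∣≤r r≤n in inside ∷ q , in⊆in p⊆q , cong suc ∣q∣≡r
-- The head is left out as long as the tail has room for `r` elements; otherwise `r` is the full
-- size and only `⊤` remains.
enlarge {n = suc n} (outside ∷ p) {r} ∣p∣≤r r≤1+n with ℕ.m≤n⇒m<n∨m≡n r≤1+n
... | inj₁ (s≤s r≤n) =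
  let q , p⊆q , ∣q∣≡r = enlarge p ∣p∣≤r r≤n in outside ∷ q , s⊆s p⊆q , ∣q∣≡r
... | inj₂ refl      = ⊤ , ⊆⊤ , ∣⊤∣≡n (suc n)

-- Applied to `⊤` it lists all candidate hyperedges; applied to a set of bounded size it is a box
-- with boundedly many entries.
subsetsOf : Subset n → List (Subset n)
subsetsOf []            = [] ∷ []
subsetsOf (outside ∷ p) = mapₗ (outside ∷_) (subsetsOf p)
subsetsOf (inside  ∷ p) = mapₗ (outside ∷_) (subsetsOf p) ++ₗ mapₗ (inside ∷_) (subsetsOf p)

length-subsetsOf : (p : Subset n) → length (subsetsOf p) ≡ 2 ^ ∣ p ∣
length-subsetsOf []            = refl
length-subsetsOf (outside ∷ p) = trans (List.length-map _ (subsetsOf p)) (length-subsetsOf p)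
length-subsetsOf (inside  ∷ p) = trans
  (List.length-++ (mapₗ (outside ∷_) (subsetsOf p)))
  (cong₂ _+_ (trans (List.length-map _ (subsetsOf p)) (length-subsetsOf p))
             (trans (List.length-map _ (subsetsOf p))
                    (trans (length-subsetsOf p) (sym (ℕ.+-identityʳ _)))))

∈-subsetsOf : (q p : Subset n) → q ⊆ p → q ∈ₗ subsetsOf p
∈-subsetsOf []            []            q⊆p = here refl
∈-subsetsOf (outside ∷ q) (outside ∷ p) q⊆p = ∈-map⁺ _ (∈-subsetsOf q p (drop-∷-⊆ q⊆p))
∈-subsetsOf (inside  ∷ q) (outside ∷ p) q⊆p with () ← q⊆p here
∈-subsetsOf (outside ∷ q) (inside  ∷ p) q⊆p = ∈-++⁺ˡ (∈-map⁺ _ (∈-subsetsOf q p (drop-∷-⊆ q⊆p)))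
∈-subsetsOf (inside  ∷ q) (inside  ∷ p) q⊆p =
  ∈-++⁺ʳ (mapₗ (outside ∷_) (subsetsOf p)) (∈-map⁺ _ (∈-subsetsOf q p (drop-∷-⊆ q⊆p)))

-- Duplicate-free lists

module _ {A : Set} where

  lookup-injective : {xs : List A} → Unique xs → Injective _≡_ _≡_ (lookup xs)
  lookup-injective (_ ∷ _)         {zero}  {zero}  _  = refl
  lookup-injective (x∉xs ∷ _)      {zero}  {suc j} eq = contradiction eq (All.lookup x∉xs (∈-lookup j))
  lookup-injective (x∉xs ∷ _)      {suc i} {zero}  eq =
    contradiction (sym eq) (All.lookup x∉xs (∈-lookup i))
  lookup-injective (_ ∷ xs-unique) {suc i} {suc j} eq = cong suc (lookup-injective xs-unique eq)

  index-injective : {xs : List A} {x y : A} (x∈ : x ∈ₗ xs) (y∈ : y ∈ₗ xs) → index x∈ ≡ index y∈ → x ≡ y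
  index-injective = Membership.index-injective (setoid A)

  -- Sending each position of `xs` to a position of the same entry in `ys` is an injection between
  -- finite index sets.
  unique⇒length≤ : {xs ys : List A} → Unique xs → xs ⊆ₗ ys → length xs ≤ length ys
  unique⇒length≤ xs-unique xs⊆ys = injective⇒≤ {f = λ i → index (xs⊆ys (∈-lookup i))}
    λ eq → lookup-injective xs-unique (index-injective _ _ eq)

  length-concatMap≤ : {B : Set} (f : B → List A) {c : ℕ} → (∀ x → length (f x) ≤ c) →
                      ∀ xs → length (concatMap f xs) ≤ length xs * c
  length-concatMap≤ f bound []       = z≤n
  length-concatMap≤ f bound (x ∷ xs) = ≤-trans
    (≤-reflexive (List.length-++ (f x)))
    (+-mono-≤ (bound x) (length-concatMap≤ f bound xs))

  -- One greedy pass over the candidates. Failure is recorded for the list `ys` held when `x` was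
  -- rejected; carrying it over to the final `xs` is left to the user of the lemma.
  maximal-extension :
    {P : List A → Set} → Decidable P → (candidates start : List A) → P start →
    ∃[ xs ] start ⊆ₗ xs × P xs ×
      (∀ {x} → x ∈ₗ candidates → x ∉ₗ xs → ∃[ ys ] ys ⊆ₗ xs × P ys × ¬ P (x ∷ ys))
  maximal-extension P? [] start p = start , id , p , λ ()
  maximal-extension P? (c ∷ cs) start p with P? (c ∷ start)
  ... | yes q =
    let xs , start⊆ , Pxs , maximal = maximal-extension P? cs (c ∷ start) q
    in xs , start⊆ ∘ there , Pxs , λ where
      (here refl) c∉xs → contradiction (start⊆ (here refl)) c∉xs
      (there x∈)  x∉xs → maximal x∈ x∉xs
  ... | no ¬q =
    let xs , start⊆ , Pxs , maximal = maximal-extension P? cs start p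
    in xs , start⊆ , Pxs , λ where
      (here refl) _    → start , start⊆ , p , ¬q
      (there x∈)  x∉xs → maximal x∈ x∉xs

-- Berge copies and saturation

-- The search runs over numeric codes of functions. Decoding the code of `f` gives a function only
-- pointwise equal to `f`, so `P` has to respect `≗`.
any-function? : {P : (Fin m → Fin n) → Set} → (∀ {f g} → f ≗ g → P f → P g) →
                Decidable P → Dec (∃ P)
any-function? {P = P} resp P? = map′
  (λ (i , Pi) → finToFun i , Pi)
  (λ (f , Pf) → funToFin f , resp (sym ∘ finToFun-funToFin f) Pf)
  (any? (P? ∘ finToFun))

injective? : (f : Fin m → Fin n) → Dec (Injective _≡_ _≡_ f)
injective? f = map′ (λ inj {x} {y} → inj x y) (λ inj x y → inj)
  (all? λ x → all? λ y → (f x ≟ f y) →-dec (x ≟ y))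

injective-resp : {f g : Fin m → Fin n} → f ≗ g → Injective _≡_ _≡_ f → Injective _≡_ _≡_ g
injective-resp f≗g f-inj {x} {y} eq = f-inj (trans (f≗g x) (trans eq (sym (f≗g y))))

containsBerge? : (F : Graph) (H : List (Subset n)) → Dec (ContainsBerge F H)
containsBerge? F H =
  any-function?
    (λ {ι} {ι′} eq (ι-inj , φ , φ-inj , inc) →
      injective-resp eq ι-inj , φ , φ-inj , λ i x x∈ → subst (_∈ lookup H (φ i)) (eq x) (inc i x x∈))
    λ ι → injective? ι ×-dec
      any-function?
        (λ {φ} {φ′} eq (φ-inj , inc) →
          injective-resp eq φ-inj , λ i x x∈ → subst (λ j → ι x ∈ lookup H j) (eq i) (inc i x x∈))
        λ φ → injective? φ ×-dec
          all? λ i → all? λ x → (x ∈? lookup (edges F) i) →-dec (ι x ∈? lookup H (φ i))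

-- Hyperedges are chosen as sets instead of list positions, which makes copies monotone under
-- inclusion of lists.
BergeCopy : (F : Graph) {n : ℕ} → List (Subset n) → Set
BergeCopy F {n} H =
  Σ (Fin (Graph.m F) → Fin n) λ ι → Injective _≡_ _≡_ ι ×
  Σ (Fin (length (edges F)) → Subset n) λ ψ → Injective _≡_ _≡_ ψ ×
  (∀ i → ψ i ∈ₗ H) × (∀ i x → x ∈ lookup (edges F) i → ι x ∈ ψ i)

module _ (F : Graph) where

  copy⇒contains : {H : List (Subset n)} → BergeCopy F H → ContainsBerge F H
  copy⇒contains (ι , ι-inj , ψ , ψ-inj , ψ∈H , inc) =
    ι , ι-inj , (λ i → index (ψ∈H i)) , (λ eq → ψ-inj (index-injective _ _ eq)) ,
    λ i x x∈ → subst (ι x ∈_) (lookup-index (ψ∈H i)) (inc i x x∈)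

  -- Uniqueness of `H` ensures that distinct positions carry distinct sets.
  contains⇒copy : {H : List (Subset n)} → Unique H → ContainsBerge F H → BergeCopy F H
  contains⇒copy {H = H} H-unique (ι , ι-inj , φ , φ-inj , inc) =
    ι , ι-inj , lookup H ∘ φ , (λ eq → φ-inj (lookup-injective H-unique eq)) ,
    (λ i → ∈-lookup (φ i)) , inc

  copy-mono : {H H′ : List (Subset n)} → H ⊆ₗ H′ → BergeCopy F H → BergeCopy F H′
  copy-mono H⊆H′ (ι , ι-inj , ψ , ψ-inj , ψ∈H , inc) =
    ι , ι-inj , ψ , ψ-inj , H⊆H′ ∘ ψ∈H , inc

  Admissible : ℕ → List (Subset n) → Set
  Admissible k H = All (λ e → ∣ e ∣ ≡ k) H × Unique H × ¬ ContainsBerge F H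

  admissible? : ∀ k → Decidable (Admissible {n} k)
  admissible? k H = All.all? (λ e → ∣ e ∣ ℕ.≟ k) H ×-dec
    UniqueDec.unique? _≟ˢ_ H ×-dec ¬? (containsBerge? F H)

  saturate : ∀ k (H₀ : List (Subset n)) → Admissible k H₀ →
             ∃[ H ] H₀ ⊆ₗ H × Saturated F k n H
  saturate k H₀ adm =
    let H , H₀⊆H , (H-k , H-unique , H-free) , maximal =
          maximal-extension (admissible? k) (subsetsOf ⊤) H₀ adm
    in H , H₀⊆H , H-k , H-unique , H-free , λ e ∣e∣≡k e∉H →
      let ys , ys⊆H , (ys-k , ys-unique , _) , ¬adm = maximal (∈-subsetsOf e ⊤ ⊆⊤) e∉H
          e∷ys-unique = All.tabulate (λ { y∈ys refl → e∉H (ys⊆H y∈ys) }) ∷ ys-unique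
          -- `e ∷ ys` is uniform and duplicate-free, so its rejection can only be due to a Berge
          -- copy; monotonicity then moves that copy into `e ∷ H`.
          contains = decidable-stable (containsBerge? F (e ∷ ys)) λ free →
            ¬adm (∣e∣≡k ∷ ys-k , e∷ys-unique , free)
      in copy⇒contains (copy-mono (λ { (here eq) → here eq ; (there z∈) → there (ys⊆H z∈) })
           (contains⇒copy e∷ys-unique contains))

-- Vertex covers

module _ (F : Graph) where

  vertexCover? : Decidable (IsVertexCover F)
  vertexCover? A = All.all? (λ e → any? λ x → (x ∈? e) ×-dec (x ∈? A)) (edges F)

  ⊤-cover : IsVertexCover F ⊤
  ⊤-cover = All.map
    (λ {e} ∣e∣≡2 → let x , y , _ , e≡ = ∣p∣≡2⇒p≡⁅x⁆∪⁅y⁆ e ∣e∣≡2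
                   in x , subst (x ∈_) (sym e≡) (x∈⁅x⁆∪⁅y⁆ x y) , ∈⊤)
    (edges-2 F)

  -- Descent on the size, starting from `⊤`: whether a smaller cover exists is decidable because
  -- there are finitely many subsets.
  minimum-cover : ∃[ C ] IsVertexCover F C × CoverNumberAtLeast F ∣ C ∣
  minimum-cover = descend ⊤ (<-wellFounded _) ⊤-cover
    where
    descend : ∀ C → Acc _<_ ∣ C ∣ → IsVertexCover F C →
              ∃[ D ] IsVertexCover F D × CoverNumberAtLeast F ∣ D ∣
    descend C (acc rec) C-cover with anySubset? (λ D → vertexCover? D ×-dec (∣ D ∣ <? ∣ C ∣))
    ... | yes (D , D-cover , D<C) = descend D (rec D<C) D-cover
    ... | no ¬smaller = C , C-cover , λ D D-cover → ≮⇒≥ λ D<C → ¬smaller (D , D-cover , D<C)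

-- Distinct representing sets

-- The cyclic shift. On at least two points it is a permutation without fixed points, so the
-- complement of `⁅ rotate a ⁆` contains `a`.
rotate : Fin (suc n) → Fin (suc n)
rotate zero    = fromℕ _
rotate (suc i) = inject₁ i

rotate-injective : Injective _≡_ _≡_ (rotate {n})
rotate-injective {x = zero}  {zero}  _  = refl
rotate-injective {x = zero}  {suc j} eq = contradiction eq fromℕ≢inject₁
rotate-injective {x = suc i} {zero}  eq = contradiction (sym eq) fromℕ≢inject₁
rotate-injective {x = suc i} {suc j} eq = cong suc (inject₁-injective eq)

rotate-≢ : (i : Fin (2 + n)) → i ≢ rotate i
rotate-≢ (suc i) eq = ℕ.1+n≢n (trans (cong toℕ eq) (toℕ-inject₁ i))

-- The sets rep a let an outer vertex x be joined to all b hubs by the distinct hyperedges rep a ∪ {x}.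
record Representatives (b r : ℕ) : Set where
  field
    rep           : Fin b → Subset b
    rep-injective : Injective _≡_ _≡_ rep
    ∈-rep         : ∀ a → a ∈ rep a
    ∣rep∣         : ∀ a → ∣ rep a ∣ ≡ r

-- Induction on `b` from `b = r + 1`, where complements of single points serve. Each further hub is
-- put in front with a set containing it; the older sets avoid it, so all stay distinct.
representatives : ∀ {b r} → 1 ≤ r → suc r ≤′ b → Representatives b r
representatives {r = suc r} _ ≤′-refl = record
  { rep           = λ a → ∁ ⁅ rotate a ⁆
  ; rep-injective = λ {a} {a′} eq → rotate-injective (x∈⁅y⁆⇒x≡y (rotate a′)
      (x∉∁p⇒x∈p (subst (rotate a ∉_) eq (x∈p⇒x∉∁p (x∈⁅x⁆ (rotate a))))))
  ; ∈-rep         = λ a → x∉p⇒x∈∁p (x≢y⇒x∉⁅y⁆ (rotate-≢ a))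
  ; ∣rep∣         = λ a → trans (∣∁p∣≡n∸∣p∣ ⁅ rotate a ⁆) (cong (suc (suc r) ∸_) (∣⁅x⁆∣≡1 (rotate a)))
  }
representatives {suc b} {suc r} 1≤r (≤′-step r<b) = record
  { rep = rep′ ; rep-injective = rep′-injective ; ∈-rep = ∈-rep′ ; ∣rep∣ = ∣rep′∣ }
  where
  open Representatives (representatives 1≤r r<b)
  first : ∃[ q ] ⊥ ⊆ q × ∣ q ∣ ≡ r
  first = enlarge ⊥ (≤-trans (≤-reflexive (∣⊥∣≡0 b)) z≤n)
    (≤-trans (ℕ.n≤1+n r) (≤-trans (ℕ.n≤1+n _) (ℕ.≤′⇒≤ r<b)))
  rep′ : Fin (suc b) → Subset (suc b)
  rep′ zero    = inside ∷ proj₁ first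
  rep′ (suc a) = outside ∷ rep a
  rep′-injective : Injective _≡_ _≡_ rep′
  rep′-injective {zero}  {zero}  _  = refl
  rep′-injective {suc a} {suc c} eq = cong suc (rep-injective (∷-injectiveʳ eq))
  ∈-rep′ : ∀ a → a ∈ rep′ a
  ∈-rep′ zero    = here
  ∈-rep′ (suc a) = there (∈-rep a)
  ∣rep′∣ : ∀ a → ∣ rep′ a ∣ ≡ suc r
  ∣rep′∣ zero    = cong suc (proj₂ (proj₂ first))
  ∣rep′∣ (suc a) = ∣rep∣ a

-- Central hyperedges

AtMostOneOutside : ∀ b → Subset (b + n) → Set
AtMostOneOutside b h = ∀ x y → (b ↑ʳ x) ∈ h → (b ↑ʳ y) ∈ h → x ≡ y

Central : ∀ b → ℕ → Subset (b + n) → Set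
Central b k h = ∣ h ∣ ≡ k × AtMostOneOutside b h

central? : ∀ b k → Decidable (Central {n} b k)
central? b k h = (∣ h ∣ ℕ.≟ k) ×-dec
  all? λ x → all? λ y → ((b ↑ʳ x) ∈? h) →-dec (((b ↑ʳ y) ∈? h) →-dec (x ≟ y))

++⊥-atMostOneOutside : (p : Subset b) → AtMostOneOutside {n} b (p ++ ⊥)
++⊥-atMostOneOutside p x y x∈ _ = contradiction (∈-++⁻ᴿ p x∈) ∉⊥

++⁅⁆-atMostOneOutside : (p : Subset b) (v : Fin n) → AtMostOneOutside b (p ++ ⁅ v ⁆)
++⁅⁆-atMostOneOutside p v x y x∈ y∈ =
  trans (x∈⁅y⁆⇒x≡y v (∈-++⁻ᴿ p x∈)) (sym (x∈⁅y⁆⇒x≡y v (∈-++⁻ᴿ p y∈)))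

∣p++⁅v⁆∣ : (p : Subset b) (v : Fin n) → ∣ p ++ ⁅ v ⁆ ∣ ≡ suc ∣ p ∣
∣p++⁅v⁆∣ p v = trans (∣p++q∣≡∣p∣+∣q∣ p ⁅ v ⁆) (trans (cong (∣ p ∣ +_) (∣⁅x⁆∣≡1 v)) (ℕ.+-comm ∣ p ∣ 1))

module _ {P : Fin n → Set} (P? : Decidable P) where

  comprehension : Subset n
  comprehension = tabulate (does ∘ P?)

  ∈-comprehension⁺ : ∀ {x} → P x → x ∈ comprehension
  ∈-comprehension⁺ {x} Px = lookup⇒[]= x _ (trans (lookup∘tabulate _ x) (dec-true (P? x) Px))

  ∈-comprehension⁻ : ∀ {x} → x ∈ comprehension → P x
  ∈-comprehension⁻ {x} x∈ with P? x | trans (sym (lookup∘tabulate (does ∘ P?) x)) ([]=⇒lookup x∈)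
  ... | yes Px | _ = Px

-- The vertices of F placed on hubs form a vertex cover with at most b elements.
no-central-copy : (F : Graph) → CoverNumberAtLeast F (suc b) → {H : List (Subset (b + n))} →
                  All (AtMostOneOutside b) H → ¬ BergeCopy F H
no-central-copy {b} {n} F β H-central (ι , ι-inj , ψ , _ , ψ∈H , inc) =
  ℕ.<⇒≱ (β hubs hubs-cover) ∣hubs∣≤b
  where
  OnHub : Fin (Graph.m F) → Set
  OnHub x = ∃[ j ] j ↑ˡ n ≡ ι x
  onHub? : Decidable OnHub
  onHub? x = any? λ j → (j ↑ˡ n) ≟ ι x
  hubs : Subset (Graph.m F)
  hubs = comprehension onHub?
  hubOf : (i : Fin ∣ hubs ∣) → OnHub (enumerate hubs i)
  hubOf i = ∈-comprehension⁻ onHub? (enumerate-∈ hubs i)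
  ∣hubs∣≤b : ∣ hubs ∣ ≤ b
  -- Since `ι` is injective, each hub hosts at most one vertex of `F`.
  ∣hubs∣≤b = injective⇒≤ {f = proj₁ ∘ hubOf} λ {i} {j} eq → enumerate-injective hubs (ι-inj
    (trans (sym (proj₂ (hubOf i))) (trans (cong (_↑ˡ n) eq) (proj₂ (hubOf j)))))
  onHub∨ : ∀ {x y} → x ≢ y → {h : Subset (b + n)} → AtMostOneOutside b h → ι x ∈ h → ι y ∈ h →
           OnHub x ⊎ OnHub y
  onHub∨ {x} {y} x≢y one x∈ y∈ with locate b (ι x) | locate b (ι y)
  ... | inj₁ x-hub | _          = inj₁ x-hub
  ... | inj₂ _     | inj₁ y-hub = inj₂ y-hub
  -- Two ends outside the hubs would share the single outer vertex of `h`, against injectivity of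
  -- `ι`.
  ... | inj₂ (v , v≡) | inj₂ (w , w≡) = contradiction (ι-inj ιx≡ιy) x≢y
    where
    ιx≡ιy : ι x ≡ ι y
    ιx≡ιy = trans (sym v≡) (trans
      (cong (b ↑ʳ_) (one v w (subst (_∈ _) (sym v≡) x∈) (subst (_∈ _) (sym w≡) y∈))) w≡)
  hubs-cover : IsVertexCover F hubs
  hubs-cover = All.tabulate λ {e} e∈ → covers e∈ (∣p∣≡2⇒p≡⁅x⁆∪⁅y⁆ e (All.lookup (edges-2 F) e∈))
    where
    covers : ∀ {e} → e ∈ₗ edges F → ∃₂ (λ x y → x ≢ y × e ≡ ⁅ x ⁆ ∪ ⁅ y ⁆) →
             ∃[ x ] x ∈ e × x ∈ hubs
    covers e∈ (x , y , x≢y , refl)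
      with onHub∨ x≢y (All.lookup H-central (ψ∈H (index e∈)))
             (inc (index e∈) x (subst (x ∈_) (lookup-index e∈) (x∈⁅x⁆∪⁅y⁆ x y)))
             (inc (index e∈) y (subst (y ∈_) (lookup-index e∈) (y∈⁅x⁆∪⁅y⁆ x y)))
    ... | inj₁ x-hub = x , x∈⁅x⁆∪⁅y⁆ x y , ∈-comprehension⁺ onHub? x-hub
    ... | inj₂ y-hub = y , y∈⁅x⁆∪⁅y⁆ x y , ∈-comprehension⁺ onHub? y-hub

-- Embedding a graph around a Berge star

-- Hyperedges for the edges of `F` between two hubs, where `i` is the index of the edge. Recovering
-- either `i` or the pair of hubs from the hyperedge suffices, as each determines the edge. Avoiding
-- `outer` separates these hyperedges from those at image vertices.
record InnerEdges (b n k s : ℕ) {t : ℕ} (outer : Fin t → Fin n) : Set where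
  field
    inner           : Fin s → Fin b → Fin b → Subset (b + n)
    inner-central   : ∀ i {j j′} → j ≢ j′ → Central b k (inner i j j′)
    inner-∈ˡ        : ∀ i j j′ → (j ↑ˡ n) ∈ inner i j j′
    inner-∈ʳ        : ∀ i j j′ → (j′ ↑ˡ n) ∈ inner i j j′
    inner-injective : ∀ {i i′ j j′ l l′} → inner i j j′ ≡ inner i′ l l′ →
                      i ≡ i′ ⊎ ⁅ j ⁆ ∪ ⁅ j′ ⁆ ≡ ⁅ l ⁆ ∪ ⁅ l′ ⁆
    inner-avoids    : ∀ i j j′ w → (b ↑ʳ outer w) ∉ inner i j j′

-- For k = 2 a pair of hubs is itself a hyperedge; for k ≥ 3 the hyperedges of distinct edges are told
-- apart by an outer vertex own i reserved for edge i.
innerEdges : ∀ {b n r s t} {outer : Fin t → Fin n} → 1 ≤ r → r ≤ b →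
             (own : Fin s → Fin n) → Injective _≡_ _≡_ own →
             (∀ i w → outer w ≢ own i) → InnerEdges b n (suc r) s outer
innerEdges {b} {n} {suc zero} _ _ _ _ _ = record
  { inner           = λ _ j j′ → (⁅ j ⁆ ∪ ⁅ j′ ⁆) ++ ⊥
  ; inner-central   = λ _ {j} {j′} j≢j′ →
      trans (∣p++q∣≡∣p∣+∣q∣ (⁅ j ⁆ ∪ ⁅ j′ ⁆) (⊥ {n = n})) (cong₂ _+_ (∣⁅x⁆∪⁅y⁆∣≡2 j≢j′) (∣⊥∣≡0 n)) ,
      ++⊥-atMostOneOutside (⁅ j ⁆ ∪ ⁅ j′ ⁆)
  ; inner-∈ˡ        = λ _ j j′ → ∈-++⁺ᴸ ⊥ (x∈⁅x⁆∪⁅y⁆ j j′)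
  ; inner-∈ʳ        = λ _ j j′ → ∈-++⁺ᴸ ⊥ (y∈⁅x⁆∪⁅y⁆ j j′)
  ; inner-injective = λ eq → inj₂ (++-injectiveˡ _ _ eq)
  ; inner-avoids    = λ _ j j′ w w∈ → ∉⊥ (∈-++⁻ᴿ (⁅ j ⁆ ∪ ⁅ j′ ⁆) w∈)
  }
innerEdges {b} {n} {suc (suc r)} _ r≤b own own-injective fresh = record
  { inner           = λ i j j′ → core j j′ ++ ⁅ own i ⁆
  ; inner-central   = λ i {j} {j′} _ →
      trans (∣p++⁅v⁆∣ (core j j′) (own i)) (cong suc (proj₂ (proj₂ (enlarged j j′)))) ,
      ++⁅⁆-atMostOneOutside (core j j′) (own i)
  ; inner-∈ˡ        = λ i j j′ → ∈-++⁺ᴸ ⁅ own i ⁆ (proj₁ (proj₂ (enlarged j j′)) (x∈⁅x⁆∪⁅y⁆ j j′))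
  ; inner-∈ʳ        = λ i j j′ → ∈-++⁺ᴸ ⁅ own i ⁆ (proj₁ (proj₂ (enlarged j j′)) (y∈⁅x⁆∪⁅y⁆ j j′))
  ; inner-injective = λ {_} {_} {j} {j′} {l} {l′} eq →
      inj₁ (own-injective (⁅⁆-injective (++-injectiveʳ (core j j′) (core l l′) eq)))
  ; inner-avoids    = λ i j j′ w w∈ → fresh i w (x∈⁅y⁆⇒x≡y (own i) (∈-++⁻ᴿ (core j j′) w∈))
  }
  where
  enlarged : ∀ j j′ → ∃[ q ] ⁅ j ⁆ ∪ ⁅ j′ ⁆ ⊆ q × ∣ q ∣ ≡ suc (suc r)
  enlarged j j′ = enlarge (⁅ j ⁆ ∪ ⁅ j′ ⁆) (≤-trans (∣⁅x⁆∪⁅y⁆∣≤2 j j′) (s≤s (s≤s z≤n))) r≤b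
  core : Fin b → Fin b → Subset b
  core j j′ = proj₁ (enlarged j j′)

-- Edges inside the hubs use `inner`, edges from a hub to a non-hub use `cross`, and edges from the
-- centre to a non-hub use `star`. The three families are disjoint: `cross` contains an outer image
-- vertex, `inner` contains none, and a star ray contains two.
module Embedding
  (F : Graph) {b n r : ℕ}
  (hub : Fin b → Fin (Graph.m F)) (hub-injective : Injective _≡_ _≡_ hub)
  (centre : Fin (Graph.m F)) (hub≢centre : ∀ j → hub j ≢ centre)
  (covers : ∀ {e} → e ∈ₗ edges F → ∃[ x ] x ∈ e × ((∃[ j ] hub j ≡ x) ⊎ centre ≡ x))
  (outer : Fin (Graph.m F) → Fin n) (outer-injective : Injective _≡_ _≡_ outer)
  (reps : Representatives b r)
  (inners : InnerEdges b n (suc r) (length (edges F)) outer)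
  (star : Fin (Graph.m F) → Subset (b + n)) (star-injective : Injective _≡_ _≡_ star)
  (∈-star-centre : ∀ {w} → w ≢ centre → (b ↑ʳ outer centre) ∈ star w)
  (∈-star : ∀ {w} → w ≢ centre → (b ↑ʳ outer w) ∈ star w)
  (H : List (Subset (b + n))) (central⊆H : ∀ {h} → Central b (suc r) h → h ∈ₗ H)
  (star⊆H : ∀ w → star w ∈ₗ H)
  where

  open Representatives reps
  open InnerEdges inners

  V = Fin (Graph.m F)

  NonHub : V → Set
  NonHub x = ∀ j → hub j ≢ x

  hub? : ∀ x → (∃[ j ] hub j ≡ x) ⊎ NonHub x
  hub? x with any? (λ j → hub j ≟ x)
  ... | yes x-hub = inj₁ x-hub
  ... | no ¬x-hub = inj₂ λ j eq → ¬x-hub (j , eq)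

  -- The decision whether `x` is a hub is an explicit argument, so injectivity follows by cases on
  -- two decisions.
  place : ∀ {x} → (∃[ j ] hub j ≡ x) ⊎ NonHub x → Fin (b + n)
  place         (inj₁ (j , _)) = j ↑ˡ n
  place {x = x} (inj₂ _)       = b ↑ʳ outer x

  place-injective : ∀ {x y} (p : (∃[ j ] hub j ≡ x) ⊎ NonHub x) (q : (∃[ j ] hub j ≡ y) ⊎ NonHub y) →
                    place p ≡ place q → x ≡ y
  place-injective (inj₁ (j , refl)) (inj₁ (l , refl)) eq = cong hub (↑ˡ-injective n j l eq)
  place-injective (inj₁ (j , _))    (inj₂ _)          eq = contradiction eq (↑ˡ≢↑ʳ j _)
  place-injective (inj₂ _)          (inj₁ (l , _))    eq = contradiction (sym eq) (↑ˡ≢↑ʳ l _)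
  place-injective (inj₂ _)          (inj₂ _)          eq = outer-injective (↑ʳ-injective b _ _ eq)

  ι : V → Fin (b + n)
  ι x = place (hub? x)

  ι-hub : ∀ j → ι (hub j) ≡ j ↑ˡ n
  ι-hub j with hub? (hub j)
  ... | inj₁ (l , eq) = cong (_↑ˡ n) (hub-injective eq)
  ... | inj₂ nonhub   = contradiction refl (nonhub j)

  ι-nonhub : ∀ {x} → NonHub x → ι x ≡ b ↑ʳ outer x
  ι-nonhub {x} nonhub with hub? x
  ... | inj₁ (j , eq) = contradiction eq (nonhub j)
  ... | inj₂ _        = refl

  -- These cases are exhaustive because the hubs and the centre cover all edges. In `hub-out` the
  -- vertex `w` may be the centre.
  data Kind : Subset (Graph.m F) → Set where
    hub-hub : ∀ j j′ → j ≢ j′ → Kind (⁅ hub j ⁆ ∪ ⁅ hub j′ ⁆)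
    hub-out : ∀ j w → NonHub w → Kind (⁅ hub j ⁆ ∪ ⁅ w ⁆)
    centred : ∀ w → NonHub w → w ≢ centre → Kind (⁅ centre ⁆ ∪ ⁅ w ⁆)

  kind : ∀ {e} → e ∈ₗ edges F → Kind e
  kind {e} e∈ with ∣p∣≡2⇒p≡⁅x⁆∪⁅y⁆ e (All.lookup (edges-2 F) e∈)
  ... | x , y , x≢y , refl with hub? x | hub? y
  ... | inj₁ (j , refl) | inj₁ (l , refl) = hub-hub j l (x≢y ∘ cong hub)
  ... | inj₁ (j , refl) | inj₂ y-non      = hub-out j y y-non
  ... | inj₂ x-non      | inj₁ (l , refl) = subst Kind (∪-comm ⁅ y ⁆ ⁅ x ⁆) (hub-out l x x-non)
  -- Neither end is a hub, so the covering vertex must be the centre.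
  ... | inj₂ x-non      | inj₂ y-non with covers e∈
  ...   | z , z∈ , z-cover with ∈-pair⁻ x y z∈ | z-cover
  ...     | inj₁ refl | inj₁ (j , eq) = contradiction eq (x-non j)
  ...     | inj₂ refl | inj₁ (j , eq) = contradiction eq (y-non j)
  ...     | inj₁ refl | inj₂ refl     = centred y y-non (≢-sym x≢y)
  ...     | inj₂ refl | inj₂ refl     = subst Kind (∪-comm ⁅ y ⁆ ⁅ x ⁆) (centred x x-non x≢y)

  cross : Fin b → V → Subset (b + n)
  cross j w = rep j ++ ⁅ outer w ⁆

  ∈-cross : ∀ j w → (b ↑ʳ outer w) ∈ cross j w
  ∈-cross j w = ∈-++⁺ᴿ (rep j) (x∈⁅x⁆ (outer w))

  cross-one : ∀ j w → AtMostOneOutside b (cross j w)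
  cross-one j w = ++⁅⁆-atMostOneOutside (rep j) (outer w)

  hyperedge : ∀ {e} → Fin (length (edges F)) → Kind e → Subset (b + n)
  hyperedge i (hub-hub j j′ _) = inner i j j′
  hyperedge i (hub-out j w _)  = cross j w
  hyperedge i (centred w _ _)  = star w

  hyperedge∈H : ∀ {e} i (κ : Kind e) → hyperedge i κ ∈ₗ H
  hyperedge∈H i (hub-hub j j′ j≢j′) = central⊆H (inner-central i j≢j′)
  hyperedge∈H i (hub-out j w _)     = central⊆H
    (trans (∣p++⁅v⁆∣ (rep j) (outer w)) (cong suc (∣rep∣ j)) , cross-one j w)
  hyperedge∈H i (centred w _ _)     = star⊆H w

  ι∈hyperedge : ∀ {e} i (κ : Kind e) {x} → x ∈ e → ι x ∈ hyperedge i κ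
  ι∈hyperedge i (hub-hub j j′ _) x∈ with ∈-pair⁻ (hub j) (hub j′) x∈
  ... | inj₁ refl = subst (_∈ _) (sym (ι-hub j)) (inner-∈ˡ i j j′)
  ... | inj₂ refl = subst (_∈ _) (sym (ι-hub j′)) (inner-∈ʳ i j j′)
  ι∈hyperedge i (hub-out j w w-non) x∈ with ∈-pair⁻ (hub j) w x∈
  ... | inj₁ refl = subst (_∈ _) (sym (ι-hub j)) (∈-++⁺ᴸ ⁅ outer w ⁆ (∈-rep j))
  ... | inj₂ refl = subst (_∈ _) (sym (ι-nonhub w-non)) (∈-cross j w)
  ι∈hyperedge i (centred w w-non w≢c) x∈ with ∈-pair⁻ centre w x∈
  ... | inj₁ refl = subst (_∈ _) (sym (ι-nonhub hub≢centre)) (∈-star-centre w≢c)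
  ... | inj₂ refl = subst (_∈ _) (sym (ι-nonhub w-non)) (∈-star w≢c)

  -- The images of `w` and of the centre are two outer vertices on the ray, which separates it from
  -- all central hyperedges.
  star-many : ∀ {w} → w ≢ centre → ¬ AtMostOneOutside b (star w)
  star-many w≢c one = w≢c (outer-injective (one _ _ (∈-star w≢c) (∈-star-centre w≢c)))

  inner≢cross : ∀ {i j j′ l w} → inner i j j′ ≢ cross l w
  inner≢cross {i} {j} {j′} {l} {w} eq = inner-avoids i j j′ w (subst (_ ∈_) (sym eq) (∈-cross l w))

  inner≢star : ∀ {i j j′ w} → j ≢ j′ → w ≢ centre → inner i j j′ ≢ star w
  inner≢star {i} j≢j′ w≢c eq =
    star-many w≢c (subst (AtMostOneOutside b) eq (proj₂ (inner-central i j≢j′)))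

  cross≢star : ∀ {j w w′} → w′ ≢ centre → cross j w ≢ star w′
  cross≢star {j} {w} w≢c eq = star-many w≢c (subst (AtMostOneOutside b) eq (cross-one j w))

  hub-pair : ∀ {j j′ l l′} → j ≢ j′ → ⁅ j ⁆ ∪ ⁅ j′ ⁆ ≡ ⁅ l ⁆ ∪ ⁅ l′ ⁆ →
             ⁅ hub j ⁆ ∪ ⁅ hub j′ ⁆ ≡ ⁅ hub l ⁆ ∪ ⁅ hub l′ ⁆
  hub-pair {j} {j′} j≢j′ eq with pair-injective j≢j′ eq
  ... | inj₁ (refl , refl) = refl
  ... | inj₂ (refl , refl) = ∪-comm ⁅ hub j ⁆ ⁅ hub j′ ⁆

  -- The families are pairwise disjoint, and within each one the hyperedge determines the edge or
  -- its index. The alternative `e ≡ e′` becomes equality of indices once `edges F` is known to be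
  -- duplicate-free.
  hyperedge-injective : ∀ {e e′} i i′ (κ : Kind e) (κ′ : Kind e′) →
                        hyperedge i κ ≡ hyperedge i′ κ′ → i ≡ i′ ⊎ e ≡ e′
  hyperedge-injective i i′ (hub-hub j j′ j≢) (hub-hub l l′ _) eq with inner-injective eq
  ... | inj₁ i≡i′ = inj₁ i≡i′
  ... | inj₂ pair = inj₂ (hub-pair j≢ pair)
  hyperedge-injective i i′ (hub-out j w _) (hub-out l v _) eq = inj₂ (cong₂ (λ j w → ⁅ hub j ⁆ ∪ ⁅ w ⁆)
    (rep-injective (++-injectiveˡ _ _ eq))
    (outer-injective (⁅⁆-injective (++-injectiveʳ (rep j) (rep l) eq))))
  hyperedge-injective i i′ (centred w _ _) (centred v _ _) eq =
    inj₂ (cong (λ w → ⁅ centre ⁆ ∪ ⁅ w ⁆) (star-injective eq))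
  hyperedge-injective i i′ (hub-hub _ _ _) (hub-out _ _ _) eq = contradiction eq inner≢cross
  hyperedge-injective i i′ (hub-out _ _ _) (hub-hub _ _ _) eq = contradiction (sym eq) inner≢cross
  hyperedge-injective i i′ (hub-hub _ _ j≢) (centred _ _ w≢) eq = contradiction eq (inner≢star j≢ w≢)
  hyperedge-injective i i′ (centred _ _ w≢) (hub-hub _ _ j≢) eq = contradiction (sym eq) (inner≢star j≢ w≢)
  hyperedge-injective i i′ (hub-out _ _ _) (centred _ _ w≢) eq = contradiction eq (cross≢star w≢)
  hyperedge-injective i i′ (centred _ _ w≢) (hub-out _ _ _) eq = contradiction (sym eq) (cross≢star w≢)

  copy : BergeCopy F H
  copy = ι , place-injective (hub? _) (hub? _) ,
    (λ i → hyperedge i (kind (∈-lookup i))) ,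
    (λ {i} {i′} eq → [ id , lookup-injective (edges-u F) ]′
      (hyperedge-injective i i′ (kind (∈-lookup i)) (kind (∈-lookup i′)) eq)) ,
    (λ i → hyperedge∈H i (kind (∈-lookup i))) ,
    λ i x → ι∈hyperedge i (kind (∈-lookup i))

-- Berge stars in a saturated hypergraph

∷ᶠ-injective : {A : Set} {x : A} {f : Fin n → A} → (∀ i → x ≢ f i) → Injective _≡_ _≡_ f →
               Injective _≡_ _≡_ (x ∷ᶠ f)
∷ᶠ-injective x∉f f-inj {zero}  {zero}  eq = refl
∷ᶠ-injective x∉f f-inj {zero}  {suc j} eq = contradiction eq (x∉f j)
∷ᶠ-injective x∉f f-inj {suc i} {zero}  eq = contradiction (sym eq) (x∉f i)
∷ᶠ-injective x∉f f-inj {suc i} {suc j} eq = cong suc (f-inj eq)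

-- Leaves are typed as outer vertices, which keeps them off the hubs; rays may contain hubs and
-- leaves of other rays.
record BergeStar (b : ℕ) (H : List (Subset (b + n))) (s : Fin n) (d : ℕ) : Set where
  field
    leaf           : Fin d → Fin n
    leaf-injective : Injective _≡_ _≡_ leaf
    leaf≢          : ∀ i → leaf i ≢ s
    ray            : Fin d → Subset (b + n)
    ray-injective  : Injective _≡_ _≡_ ray
    ray∈           : ∀ i → ray i ∈ₗ H
    s∈ray          : ∀ i → (b ↑ʳ s) ∈ ray i
    leaf∈ray       : ∀ i → (b ↑ʳ leaf i) ∈ ray i

Trap : (b : ℕ) → List (Subset (b + n)) → Fin n → Subset (b + n) → Set
Trap b H s T = ∀ {h} → h ∈ₗ H → (b ↑ʳ s) ∈ h → h ⊆ T

module _ (b : ℕ) {n k : ℕ} (H : List (Subset (b + n))) (H-k : All (λ h → ∣ h ∣ ≡ k) H) (s : Fin n) where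

  private
    -- Invariant of the greedy search: `T` contains the hubs, `s` and all rays so far, hence all
    -- leaves. A hyperedge through `s` that leaves `T` is thus a new ray, and its vertex outside `T`
    -- is a new leaf.
    GreedyStar : ℕ → Subset (b + n) → Set
    GreedyStar d T = Σ (BergeStar b H s d) λ S →
      (⊤ {b} ++ ⁅ s ⁆) ⊆ T × (∀ i → BergeStar.ray S i ⊆ T)

    escape? : ∀ T → Trap b H s T ⊎ ∃[ h ] h ∈ₗ H × (b ↑ʳ s) ∈ h × ∃[ u ] u ∈ h × u ∉ T
    escape? T with Any.any? (λ h → ((b ↑ʳ s) ∈? h) ×-dec any? λ u → (u ∈? h) ×-dec ¬? (u ∈? T)) H
    ... | yes escapes = inj₂ (let h , h∈ , s∈h , out = find escapes in h , h∈ , s∈h , out)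
    ... | no ¬escapes = inj₁ λ h∈ s∈h {u} u∈h → decidable-stable (u ∈? T) λ u∉T →
            ¬escapes (lose h∈ (s∈h , u , u∈h , u∉T))

    extend : ∀ {d T h v} → GreedyStar d T → h ∈ₗ H → (b ↑ʳ s) ∈ h → (b ↑ʳ v) ∈ h → (b ↑ʳ v) ∉ T →
             GreedyStar (suc d) (T ∪ h)
    extend {T = T} {h} {v} (S , base⊆T , ray⊆T) h∈ s∈h v∈h v∉T = record
      { leaf           = v ∷ᶠ leaf
      ; leaf-injective = ∷ᶠ-injective
          (λ i eq → v∉T (ray⊆T i (subst (λ w → (b ↑ʳ w) ∈ ray i) (sym eq) (leaf∈ray i)))) leaf-injective
      ; leaf≢          = λ where
          zero    refl → v∉T (base⊆T (∈-++⁺ᴿ (⊤ {b}) (x∈⁅x⁆ s)))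
          (suc i) → leaf≢ i
      ; ray            = h ∷ᶠ ray
      ; ray-injective  = ∷ᶠ-injective (λ i eq → v∉T (ray⊆T i (subst (_ ∈_) eq v∈h))) ray-injective
      ; ray∈           = λ { zero → h∈  ; (suc i) → ray∈ i }
      ; s∈ray          = λ { zero → s∈h ; (suc i) → s∈ray i }
      ; leaf∈ray       = λ { zero → v∈h ; (suc i) → leaf∈ray i }
      } , ⊆-trans base⊆T (p⊆p∪q h) , λ where
        zero    → q⊆p∪q T h
        (suc i) → ⊆-trans (ray⊆T i) (p⊆p∪q h)
      where open BergeStar S

    -- The bound counts the hubs, `s`, and `k` vertices for each ray. A trap found early is kept, as
    -- the bound only grows with `d`.
    greedy : ∀ d → ∃[ T ] ∣ T ∣ ≤ suc b + d * k × (GreedyStar d T ⊎ Trap b H s T)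
    greedy zero = ⊤ ++ ⁅ s ⁆ ,
      ≤-reflexive (trans (∣p++⁅v⁆∣ (⊤ {b}) s) (trans (cong suc (∣⊤∣≡n b)) (sym (ℕ.+-identityʳ (suc b))))) ,
      inj₁ (record { leaf = λ () ; leaf-injective = λ { {()} } ; leaf≢ = λ () ; ray = λ ()
                   ; ray-injective = λ { {()} } ; ray∈ = λ () ; s∈ray = λ () ; leaf∈ray = λ () } ,
            ⊆-refl , λ ())
    greedy (suc d) with greedy d
    ... | T , ∣T∣≤ , inj₂ trap = T , ≤-trans ∣T∣≤ (ℕ.+-monoʳ-≤ (suc b) (ℕ.m≤n+m (d * k) k)) , inj₂ trap
    ... | T , ∣T∣≤ , inj₁ S with escape? T
    ...   | inj₁ trap = T , ≤-trans ∣T∣≤ (ℕ.+-monoʳ-≤ (suc b) (ℕ.m≤n+m (d * k) k)) , inj₂ trap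
    ...   | inj₂ (h , h∈ , s∈h , u , u∈h , u∉T) with locate b u
    ...     | inj₁ (j , refl) = contradiction (proj₁ (proj₂ S) (∈-++⁺ᴸ ⁅ s ⁆ ∈⊤)) u∉T
    ...     | inj₂ (v , refl) = T ∪ h , ∣T∪h∣≤ , inj₁ (extend S h∈ s∈h u∈h u∉T)
      where
      ∣T∪h∣≤ : ∣ T ∪ h ∣ ≤ suc b + (k + d * k)
      ∣T∪h∣≤ = begin
        ∣ T ∪ h ∣               ≤⟨ ∣p∪q∣≤∣p∣+∣q∣ T h ⟩
        ∣ T ∣ + ∣ h ∣           ≤⟨ +-mono-≤ ∣T∣≤ (≤-reflexive (All.lookup H-k h∈)) ⟩
        suc b + d * k + k       ≡⟨ ℕ.+-assoc (suc b) (d * k) k ⟩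
        suc b + (d * k + k)     ≡⟨ cong (suc b +_) (ℕ.+-comm (d * k) k) ⟩
        suc b + (k + d * k)     ∎
        where open ℕ.≤-Reasoning

  star-or-trap : ∀ d → BergeStar b H s d ⊎ ∃[ T ] ∣ T ∣ ≤ suc b + d * k × Trap b H s T
  star-or-trap d with greedy d
  ... | _ , _    , inj₁ (S , _) = inj₁ S
  ... | T , ∣T∣≤ , inj₂ trap    = inj₂ (T , ∣T∣≤ , trap)

-- Saturated hypergraphs of linear size.

module _ (F : Graph) {b r : ℕ} (1≤r : 1 ≤ r) (r<b : r < b)
         (cover : Fin (suc b) → Fin (Graph.m F)) (cover-injective : Injective _≡_ _≡_ cover)
         (covering : ∀ {e} → e ∈ₗ edges F → ∃[ j ] cover j ∈ e)
         (β : CoverNumberAtLeast F (suc b)) where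

  private
    v = Graph.m F
    ε = length (edges F)
    k = suc r
    -- The bound on a trap when no star with `v + ε` rays exists; it is independent of `n`.
    D = suc b + (v + ε) * k

  -- The first v leaves host the vertices of F outside the cover, the last ε are the reserved vertices.
  star⇒copy : {H : List (Subset (b + n))} {s : Fin n} → (∀ {h} → Central b k h → h ∈ₗ H) →
              BergeStar b H s (v + ε) → BergeCopy F H
  star⇒copy {n} {H} {s} central⊆H S = Embedding.copy F
    -- Of the `b + 1` cover vertices, the first becomes the centre and the other `b` occupy the
    -- hubs.
    (cover ∘ suc) (suc-injective ∘ cover-injective)
    (cover zero) (λ j eq → contradiction (cover-injective eq) λ ())
    covers
    outer outer-injective
    (representatives 1≤r (ℕ.≤⇒≤′ r<b))
    (innerEdges 1≤r (ℕ.<⇒≤ r<b) (leaf ∘ (v ↑ʳ_)) (↑ʳ-injective v _ _ ∘ leaf-injective) fresh)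
    (λ w → ray (w ↑ˡ ε)) (↑ˡ-injective ε _ _ ∘ ray-injective)
    (λ {w} _ → subst (λ z → (b ↑ʳ z) ∈ _) (sym outer-centre) (s∈ray (w ↑ˡ ε)))
    (λ {w} w≢c → subst (λ z → (b ↑ʳ z) ∈ _) (sym (outer-leaf w≢c)) (leaf∈ray (w ↑ˡ ε)))
    H central⊆H (λ w → ray∈ (w ↑ˡ ε))
    where
    open BergeStar S
    covers : ∀ {e} → e ∈ₗ edges F → ∃[ x ] x ∈ e × ((∃[ j ] cover (suc j) ≡ x) ⊎ cover zero ≡ x)
    covers e∈ with covering e∈
    ... | zero  , c∈e = cover zero , c∈e , inj₂ refl
    ... | suc j , h∈e = cover (suc j) , h∈e , inj₁ (j , refl)
    outer : Fin v → Fin n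
    outer w with w ≟ cover zero
    ... | yes _ = s
    ... | no  _ = leaf (w ↑ˡ ε)
    outer-centre : outer (cover zero) ≡ s
    outer-centre with cover zero ≟ cover zero
    ... | yes _ = refl
    ... | no c≢c = contradiction refl c≢c
    outer-leaf : ∀ {w} → w ≢ cover zero → outer w ≡ leaf (w ↑ˡ ε)
    outer-leaf {w} w≢c with w ≟ cover zero
    ... | yes w≡c = contradiction w≡c w≢c
    ... | no _    = refl
    outer-injective : Injective _≡_ _≡_ outer
    outer-injective {w} {w′} eq with w ≟ cover zero | w′ ≟ cover zero
    ... | yes p | yes q = trans p (sym q)
    ... | yes p | no _  = contradiction (sym eq) (leaf≢ _)
    ... | no _  | yes q = contradiction eq (leaf≢ _)
    ... | no _  | no _  = ↑ˡ-injective ε w w′ (leaf-injective eq)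
    fresh : ∀ i w → outer w ≢ leaf (v ↑ʳ i)
    fresh i w eq with w ≟ cover zero
    ... | yes _ = leaf≢ _ (sym eq)
    ... | no _  = ↑ˡ≢↑ʳ w i (leaf-injective eq)

  -- Deduplication supplies the `Unique` part of admissibility directly.
  initial : ∀ n → List (Subset (b + n))
  initial n = deduplicate _≟ˢ_ (filter (central? b k) (subsetsOf ⊤))

  initial-central : ∀ {n h} → h ∈ₗ initial n → Central b k h
  initial-central {n} h∈ =
    proj₂ (∈-filter⁻ (central? b k) {xs = subsetsOf ⊤}
      (∈-deduplicate⁻ _≟ˢ_ (filter (central? b k) (subsetsOf ⊤)) h∈))

  central∈initial : ∀ {n} {h : Subset (b + n)} → Central b k h → h ∈ₗ initial n
  central∈initial h-central =
    ∈-deduplicate⁺ _≟ˢ_ (∈-filter⁺ (central? b k) (∈-subsetsOf _ ⊤ ⊆⊤) h-central)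

  initial-admissible : ∀ n → Admissible F k (initial n)
  initial-admissible n =
    All.tabulate (proj₁ ∘ initial-central) , unique ,
    no-central-copy F β (All.tabulate (proj₂ ∘ initial-central)) ∘ contains⇒copy F unique
    where
    unique : Unique (initial n)
    unique = deduplicate-! _≟ˢ_ (filter (central? b k) (subsetsOf ⊤))

  module _ {n : ℕ} {H : List (Subset (b + n))} (initial⊆H : initial n ⊆ₗ H)
           (H-saturated : Saturated F k (b + n) H) where

    private
      H-k = proj₁ H-saturated
      H-unique = proj₁ (proj₂ H-saturated)
      H-free = proj₁ (proj₂ (proj₂ H-saturated))

    trap : (s : Fin n) → ∃[ T ] ∣ T ∣ ≤ D × Trap b H s T
    trap s with star-or-trap b H H-k s (v + ε)
    ... | inj₁ S = contradiction (copy⇒contains F (star⇒copy (initial⊆H ∘ central∈initial) S)) H-free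
    ... | inj₂ t = t

    T : Fin n → Subset (b + n)
    T s = proj₁ (trap s)

    -- One box for the hyperedges inside the hubs, and one for each outer vertex `s`, holding all
    -- hyperedges through `s`.
    boxes : List (Subset (b + n))
    boxes = subsetsOf (⊤ {b} ++ ⊥) ++ₗ concatMap (subsetsOf ∘ T) (allFin n)

    H⊆boxes : H ⊆ₗ boxes
    H⊆boxes {h} h∈ with any? (λ s → (b ↑ʳ s) ∈? h)
    ... | yes (s , s∈h) = ∈-++⁺ʳ (subsetsOf (⊤ {b} ++ ⊥)) (concatMap⁺ (subsetsOf ∘ T)
      (lose (∈-allFin s) (∈-subsetsOf h (T s) (proj₂ (proj₂ (trap s)) h∈ s∈h))))
    ... | no ¬outer = ∈-++⁺ˡ (∈-subsetsOf h (⊤ {b} ++ ⊥) h⊆hubs)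
      where
      h⊆hubs : h ⊆ ⊤ {b} ++ ⊥
      h⊆hubs {x} x∈h with locate b x
      ... | inj₁ (j , refl) = ∈-++⁺ᴸ ⊥ ∈⊤
      ... | inj₂ (s , refl) = contradiction (s , x∈h) ¬outer

    length-subsetsOf≤ : ∀ (p : Subset (b + n)) → ∣ p ∣ ≤ D → length (subsetsOf p) ≤ 2 ^ D
    length-subsetsOf≤ p ∣p∣≤D = ≤-trans (≤-reflexive (length-subsetsOf p)) (ℕ.^-monoʳ-≤ 2 ∣p∣≤D)

    ∣hubs∣≤D : ∣ ⊤ {b} ++ ⊥ {n} ∣ ≤ D
    ∣hubs∣≤D = begin
      ∣ ⊤ {b} ++ ⊥ {n} ∣    ≡⟨ ∣p++q∣≡∣p∣+∣q∣ (⊤ {b}) (⊥ {n}) ⟩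
      ∣ ⊤ {b} ∣ + ∣ ⊥ {n} ∣ ≡⟨ cong₂ _+_ (∣⊤∣≡n b) (∣⊥∣≡0 n) ⟩
      b + 0                 ≤⟨ +-mono-≤ (ℕ.n≤1+n b) z≤n ⟩
      D                     ∎
      where open ℕ.≤-Reasoning

    linear : length H ≤ 2 ^ D * (b + n)
    linear = begin
      length H
        ≤⟨ unique⇒length≤ H-unique H⊆boxes ⟩
      length boxes
        ≡⟨ List.length-++ (subsetsOf (⊤ {b} ++ ⊥ {n})) ⟩
      length (subsetsOf (⊤ {b} ++ ⊥)) + length (concatMap (subsetsOf ∘ T) (allFin n))
        ≤⟨ +-mono-≤ (length-subsetsOf≤ (⊤ {b} ++ ⊥) ∣hubs∣≤D) (length-concatMap≤ (subsetsOf ∘ T)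
             (λ s → length-subsetsOf≤ (T s) (proj₁ (proj₂ (trap s)))) (allFin n)) ⟩
      2 ^ D + length (allFin n) * 2 ^ D
        ≡⟨ cong (λ l → 2 ^ D + l * 2 ^ D) (List.length-tabulate {n = n} id) ⟩
      suc n * 2 ^ D
        -- The `1 + n` boxes number at most `b + n`, because `r < b` gives `1 ≤ b`.
        ≤⟨ ℕ.*-monoˡ-≤ (2 ^ D) (ℕ.+-monoˡ-≤ n (≤-trans (s≤s z≤n) r<b)) ⟩
      (b + n) * 2 ^ D
        ≡⟨ ℕ.*-comm (b + n) (2 ^ D) ⟩
      2 ^ D * (b + n)
        ∎
      where open ℕ.≤-Reasoning

  saturated-linear : ∃[ c ] ∀ n → b ≤ n →
                     Σ (List (Subset n)) λ H → Saturated F k n H × length H ≤ c * n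
  -- Any `b` of the `n` vertices become hubs, leaving `n ∸ b` outer ones.
  saturated-linear = 2 ^ D , λ n b≤n → subst
    (λ n → Σ (List (Subset n)) λ H → Saturated F k n H × length H ≤ 2 ^ D * n)
    (ℕ.m+[n∸m]≡n b≤n)
    (let H , initial⊆H , H-saturated = saturate F k (initial (n ∸ b)) (initial-admissible (n ∸ b))
     in H , H-saturated , linear initial⊆H H-saturated)

-- Passes from a lower bound to the exact cover number `s`: the same `s` must count the vertices of
-- one cover, for the embedding, and bound every cover from below, for the absence of central
-- copies.
enumerated-minimum-cover : (F : Graph) {t : ℕ} → CoverNumberAtLeast F t →
  ∃[ s ] t ≤ s × Σ (Fin s → Fin (Graph.m F)) λ cover → Injective _≡_ _≡_ cover ×
    (∀ {e} → e ∈ₗ edges F → ∃[ j ] cover j ∈ e) × CoverNumberAtLeast F s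
enumerated-minimum-cover F β with minimum-cover F
... | C , C-cover , C-minimum = ∣ C ∣ , β C C-cover , enumerate C , enumerate-injective C ,
  (λ e∈ → let x , x∈e , x∈C = All.lookup C-cover e∈
              j , eq = enumerate-surjective C x∈C
          in j , subst (_∈ _) (sym eq) x∈e) ,
  C-minimum

theorem2p4 : (k : ℕ) → 2 ≤ k → (F : Graph) → CoverNumberAtLeast F (suc k) →
    ∃[ C ] ∃[ N ] ((n : ℕ) → N ≤ n →
    Σ (List (Subset n)) λ H → Saturated F k n H × length H ≤ C * n)
theorem2p4 (suc r) (s≤s 1≤r) F β
  -- Here `k = suc r`, and the cover number is at least `k + 1`; writing it as `suc b` gives
  -- `r < b`, that is `k ≤ b`. The threshold for `n` is `b`, the number of hubs.
  with suc b , s≤s r<b , cover , cover-injective , covering , minimum ← enumerated-minimum-cover F β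
  = let c , linear = saturated-linear F 1≤r r<b cover cover-injective covering minimum in c , b , linear
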